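{- The following two statements hold: (i) A graph $G$ is $3P_1$-pivot-minor-free if and only if it is $(3P_1, W_4, \overline{BW_3})$-free. (ii) A graph $G$ is $K_{1,3}$-pivot-minor-free if and only if it is $(K_{1,3}, P_5, \text{bull}, W_4, \overline{BW_3})$-free.
   Context: Graphs are finite, without loops or multiple edges. $3P_1$ is the graph with three vertices and no edges; $K_{1,3}$ is the star with three leaves; $P_5$ is the path on five vertices; the bull is obtained from $P_5$ by adding an edge between its second and fourth vertices; $W_4$ is obtained from the 4-cycle $C_4$ by adding one vertex adjacent to all vertices of the cycle. $BW_3$ is the seven-vertex graph obtained from the 6-cycle $C_6$ by adding one vertex adjacent to three pairwise non-adjacent vertices of the cycle, and $\overline{BW_3}$ is its complement (equivalently: a clique $\{a_1,a_2,a_3\}$ and a clique $\{b_1,b_2,b_3,b_4\}$, with exactly the edges $a_1b_1,a_2b_2,a_3b_3$ between them). A graph is $(H_1,\dots,H_p)$-free if it has no induced subgraph isomorphic to any $H_i$. For a vertex $u$ of a graph $G$, the local complementation $G*u$ is obtained from $G$ by complementing the adjacency between every pair of distinct neighbours of $u$. For an edge $uv$ of $G$, the edge pivot is $G\wedge uv=((G*u)*v)*u$. A graph $G$ contains $H$ as a pivot-minor if $H$ can be obtained from $G$ by a sequence of vertex deletions and edge pivots; $G$ is $H$-pivot-minor-free if it contains no pivot-minor isomorphic to $H$. -}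

module Defs where

open import Data.Bool.Base using (Bool; true; false; not; _∧_; _∨_; _xor_)
open import Data.Bool.Properties using (∧-comm; ∨-comm)
open import Data.Fin.Base using (Fin; punchIn)
open import Data.Fin.Patterns
open import Data.Fin.Properties using (_≟_; punchIn-injective)
open import Data.List.Base using (List; []; _∷_)
open import Data.List.Relation.Unary.All using (All)
open import Data.Nat.Base using (ℕ; suc)
open import Data.Product.Base using (∃; ∃-syntax; Σ-syntax; _×_; _,_)
open import Data.Product.Properties using (≡-dec)
open import Function.Bundles using (_↔_; _↣_; mk↣; Inverse; Injection)
open import Relation.Binary.PropositionalEquality
  using (_≡_; refl; sym; cong; cong₂)
open import Relation.Nullary using (¬_; does; yes; no; contradiction)

record Graph (n : ℕ) : Set where
  field
    adj     : Fin n → Fin n → Bool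
    adj-sym : ∀ x y → adj x y ≡ adj y x
    no-loop : ∀ x → adj x x ≡ false

open Graph public

private
  variable
    k m n : ℕ

distinct : Fin n → Fin n → Bool
distinct x y = not (does (x ≟ y))

distinct-sym : (x y : Fin n) → distinct x y ≡ distinct y x
distinct-sym x y with x ≟ y | y ≟ x
... | yes _   | yes _   = refl
... | no _    | no _    = refl
... | yes x≡y | no y≢x  = contradiction (sym x≡y) y≢x
... | no x≢y  | yes y≡x = contradiction (sym y≡x) x≢y

distinct-irrefl : (x : Fin n) → distinct x x ≡ false
distinct-irrefl x with x ≟ x
... | yes _  = refl
... | no x≢x = contradiction refl x≢x

record _≅_ (G : Graph m) (H : Graph n) : Set where
  field
    bijection : Fin m ↔ Fin n
    adj-≡     : ∀ x y → adj G x y ≡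
                adj H (Inverse.to bijection x) (Inverse.to bijection y)

-- The subgraph of G induced by the image of f, with its vertices renamed
-- along f.
induced : Graph n → Fin k ↣ Fin n → Graph k
induced G f = record
  { adj     = λ x y → adj G (to x) (to y)
  ; adj-sym = λ x y → adj-sym G (to x) (to y)
  ; no-loop = λ x → no-loop G (to x)
  }
  where open Injection f using (to)

ContainsInduced : Graph n → Graph m → Set
ContainsInduced {n} G H = ∃[ k ] Σ[ f ∈ Fin k ↣ Fin n ] induced G f ≅ H

-- An existential pair in the list carries the order of the graph.
_IsFreeOf_ : Graph n → List (∃ Graph) → Set
G IsFreeOf Hs = All (λ (_ , H) → ¬ ContainsInduced G H) Hs

deleteVertex : Graph (suc n) → Fin (suc n) → Graph n
deleteVertex G v = induced G (mk↣ (λ {x} {y} → punchIn-injective v x y))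

infixl 7 _*_

_*_ : Graph n → Fin n → Graph n
G * u = record
  { adj     = λ x y → adj G x y xor (distinct x y ∧ (adj G u x ∧ adj G u y))
  ; adj-sym = λ x y → cong₂ _xor_ (adj-sym G x y)
      (cong₂ _∧_ (distinct-sym x y) (∧-comm (adj G u x) (adj G u y)))
  ; no-loop = λ x → cong₂ _xor_ (no-loop G x)
      (cong (_∧ (adj G u x ∧ adj G u x)) (distinct-irrefl x))
  }

-- Meaningful only when u and v are adjacent, as the relation below requires.
edgePivot : Graph n → Fin n → Fin n → Graph n
edgePivot G u v = G * u * v * u

data _↝_ : Graph m → Graph n → Set where
  stop   : {G : Graph n} → G ↝ G
  delete : {G : Graph (suc m)} {K : Graph n} (v : Fin (suc m)) →
           deleteVertex G v ↝ K → G ↝ K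
  pivot  : {G : Graph m} {K : Graph n} (u v : Fin m) → adj G u v ≡ true →
           edgePivot G u v ↝ K → G ↝ K

ContainsPivotMinor : Graph n → Graph m → Set
ContainsPivotMinor G H = ∃[ k ] Σ[ K ∈ Graph k ] (G ↝ K × K ≅ H)

PivotMinorFree : Graph m → Graph n → Set
PivotMinorFree H G = ¬ ContainsPivotMinor G H

complement : Graph n → Graph n
complement G = record
  { adj     = λ x y → distinct x y ∧ not (adj G x y)
  ; adj-sym = λ x y → cong₂ (λ d a → d ∧ not a) (distinct-sym x y) (adj-sym G x y)
  ; no-loop = λ x → cong (_∧ not (adj G x x)) (distinct-irrefl x)
  }

module _ {n : ℕ} where
  open import Data.List.Membership.DecPropositional (≡-dec (_≟_ {n}) (_≟_ {n}))
    using (_∈?_)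

  -- Each edge is listed in one orientation.
  fromEdges : List (Fin n × Fin n) → Graph n
  fromEdges es = record
    { adj     = λ x y → distinct x y ∧ (listed x y ∨ listed y x)
    ; adj-sym = λ x y →
        cong₂ _∧_ (distinct-sym x y) (∨-comm (listed x y) (listed y x))
    ; no-loop = λ x → cong (_∧ (listed x x ∨ listed x x)) (distinct-irrefl x)
    }
    where
    listed : Fin n → Fin n → Bool
    listed x y = does ((x , y) ∈? es)

3P₁ : Graph 3
3P₁ = fromEdges []

K₁,₃ : Graph 4
K₁,₃ = fromEdges ((0F , 1F) ∷ (0F , 2F) ∷ (0F , 3F) ∷ [])

P₅-edges : List (Fin 5 × Fin 5)
P₅-edges = (0F , 1F) ∷ (1F , 2F) ∷ (2F , 3F) ∷ (3F , 4F) ∷ []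

P₅ : Graph 5
P₅ = fromEdges P₅-edges

bull : Graph 5
bull = fromEdges ((1F , 3F) ∷ P₅-edges)

-- The cycle is 0-1-2-3 and the hub is 4.
W₄ : Graph 5
W₄ = fromEdges
  ( (0F , 1F) ∷ (1F , 2F) ∷ (2F , 3F) ∷ (3F , 0F)
  ∷ (4F , 0F) ∷ (4F , 1F) ∷ (4F , 2F) ∷ (4F , 3F) ∷ [])

-- The cycle is 0-1-2-3-4-5 and the added vertex is 6.
BW₃ : Graph 7
BW₃ = fromEdges
  ( (0F , 1F) ∷ (1F , 2F) ∷ (2F , 3F) ∷ (3F , 4F) ∷ (4F , 5F) ∷ (5F , 0F)
  ∷ (6F , 0F) ∷ (6F , 2F) ∷ (6F , 4F) ∷ [])

{-# OPTIONS --safe #-}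

-- Each listed graph has the excluded graph H as a pivot-minor, and H is listed,
-- so it suffices that avoiding the listed graphs is preserved by pivoting. If pivoting uv in G creates an
-- induced copy of a listed graph F, the pivot may be computed inside the at most
-- |F| + 2 vertices formed by the copy, u and v. There the adjacencies in G are
-- determined by those in F and by the adjacencies to u and v, so only finitely
-- many graphs arise; a backtracking search over them always finds a listed graph
-- in G.
module Submission where

open import Defs
open import Data.Bool.Base
  using (Bool; true; false; not; T; _∧_; _∨_; _xor_)
open import Data.Bool.ListAction using (any; all)
open import Data.Bool.Properties
  using (T-≡; T-∧; T-∨; ∧-zeroʳ; xor-identityʳ)
  renaming (_≟_ to _≟ᵇ_)
open import Data.Bool.Solver using (module xor-∧-Solver)
open import Data.Fin.Base using (Fin; zero; suc; punchIn; punchOut; _<_)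
open import Data.Fin.Patterns
open import Data.Fin.Permutation.Components using (transpose; transpose-inverse)
open import Data.Fin.Properties
  using (_≟_; _<?_; any?; all?; <-cmp; punchIn-injective; punchIn-punchOut;
         punchOut-injective; suc-injective)
open import Data.List.Base
  using (List; []; _∷_; allFin; map; concatMap; filterᵇ)
import Data.List.Membership.Propositional as List
open import Data.List.Membership.Propositional.Properties using (∈-filter⁻)
open import Data.List.Relation.Unary.All as All using (All; []; _∷_)
import Data.List.Relation.Unary.All.Properties as All
open import Data.List.Relation.Unary.Any as Any using (here; there)
import Data.List.Relation.Unary.Any.Properties as Any
open import Data.Maybe.Base using (Maybe; just; nothing)
open import Data.Nat.Base using (ℕ; zero; suc; _+_; s<s)
open import Data.Product.Base
  using (∃; ∃₂; ∃-syntax; Σ-syntax; _×_; _,_; proj₁; proj₂)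
open import Data.Sum.Base using (inj₁; inj₂)
open import Data.Vec.Base
  using (Vec; []; _∷_; _++_; lookup; tabulate; zipWith; replicate)
open import Data.Vec.Properties using (lookup-zipWith; lookup∘tabulate)
open import Data.Vec.Relation.Binary.Pointwise.Inductive as Pointwise
  using (Pointwise; []; _∷_)
open import Function.Base using (_∘_)
open import Function.Bundles
  using (_⇔_; mk⇔; mk↣; mk⤖; Equivalence; Injection; Inverse)
open import Function.Construct.Identity using (↔-id)
open import Function.Properties.Bijection using (⤖⇒↔)
open import Relation.Binary.Definitions using (tri<; tri≈; tri>)
open import Relation.Binary.PropositionalEquality
open import Relation.Nullary using (¬_; yes; no; contradiction)
open import Relation.Nullary.Decidable
  using (⌊_⌋; True; toWitness; fromWitness; dec-false; ¬?; _×-dec_; _→-dec_)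

private
  variable
    A : Set
    k m n : ℕ

-- Embeddings as induced subgraphs

infix 4 _↪_ _Avoids_

record _↪_ (H : Graph m) (G : Graph n) : Set where
  field
    to        : Fin m → Fin n
    injective : ∀ {x y} → to x ≡ to y → x ≡ y
    preserves : ∀ x y → adj G (to x) (to y) ≡ adj H x y

open _↪_
open xor-∧-Solver using (solve; _:+_; _:*_; _:=_)

_Avoids_ : Graph n → List (∃ Graph) → Set
G Avoids Hs = All (λ (_ , H) → ¬ H ↪ G) Hs

↪-refl : {G : Graph n} → G ↪ G
↪-refl = record { to = λ x → x ; injective = λ e → e ; preserves = λ _ _ → refl }

↪-trans : {F : Graph k} {G : Graph m} {H : Graph n} → F ↪ G → G ↪ H → F ↪ H
↪-trans f g = record
  { to        = to g ∘ to f
  ; injective = injective f ∘ injective g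
  ; preserves = λ x y → trans (preserves g _ _) (preserves f x y)
  }

↪-ordered : {H : Graph m} {G : Graph n} (f : Fin m → Fin n) →
  (∀ {x y} → x < y → f x ≢ f y × adj G (f x) (f y) ≡ adj H x y) → H ↪ G
↪-ordered {H = H} {G = G} f ordered = record
  { to = f ; injective = λ {x} {y} → inj x y ; preserves = pres }
  where
  inj : ∀ x y → f x ≡ f y → x ≡ y
  inj x y e with <-cmp x y
  ... | tri< x<y _ _ = contradiction e (proj₁ (ordered x<y))
  ... | tri≈ _ x≡y _ = x≡y
  ... | tri> _ _ y<x = contradiction (sym e) (proj₁ (ordered y<x))

  pres : ∀ x y → adj G (f x) (f y) ≡ adj H x y
  pres x y with <-cmp x y
  ... | tri< x<y _ _  = proj₂ (ordered x<y)
  ... | tri≈ _ refl _ = trans (no-loop G _) (sym (no-loop H x))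
  ... | tri> _ _ y<x  =
    trans (adj-sym G _ _) (trans (proj₂ (ordered y<x)) (adj-sym H y x))

≅⇒↪ : {G : Graph m} {H : Graph n} → G ≅ H → H ↪ G
≅⇒↪ {G = G} {H} G≅H = record
  { to        = from
  ; injective = λ {x} {y} e →
      trans (sym (strictlyInverseˡ x)) (trans (cong toᵇ e) (strictlyInverseˡ y))
  ; preserves = λ x y → trans (adj-≡ (from x) (from y))
      (cong₂ (adj H) (strictlyInverseˡ x) (strictlyInverseˡ y))
  }
  where
  open _≅_ G≅H
  open Inverse bijection renaming (to to toᵇ)

induced⇒↪ : {G : Graph n} {H : Graph m} → ContainsInduced G H → H ↪ G
induced⇒↪ (_ , f , G[f]≅H) = ↪-trans (≅⇒↪ G[f]≅H) (record
  { to = Injection.to f ; injective = Injection.injective f ; preserves = λ _ _ → refl })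

↪⇒induced : {G : Graph n} {H : Graph m} → H ↪ G → ContainsInduced G H
↪⇒induced f =
  _ , mk↣ (injective f) , record { bijection = ↔-id _ ; adj-≡ = preserves f }

deletion-↪ : (G : Graph (suc n)) (v : Fin (suc n)) → deleteVertex G v ↪ G
deletion-↪ G v = record
  { to = punchIn v ; injective = punchIn-injective v _ _ ; preserves = λ _ _ → refl }

-- Vertices outside the image are deleted one by one; once none is left, `f` is onto and its inverse
-- is the isomorphism.
↪⇒minor : {G : Graph n} {H : Graph m} → H ↪ G → ContainsPivotMinor G H
↪⇒minor {n} {m} {G} {H} f with any? (λ v → all? λ x → ¬? (v ≟ to f x))
↪⇒minor {suc n} {m} {G} {H} f | yes (v , v-missed) =
  let k , K , deleted , K≅H = ↪⇒minor H↪G-v in k , K , delete v deleted , K≅H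
  where
  H↪G-v : H ↪ deleteVertex G v
  H↪G-v = record
    { to        = λ x → punchOut (v-missed x)
    ; injective = injective f ∘ punchOut-injective (v-missed _) (v-missed _)
    ; preserves = λ x y → trans
        (cong₂ (adj G) (punchIn-punchOut (v-missed x)) (punchIn-punchOut (v-missed y)))
        (preserves f x y)
    }
↪⇒minor {n} {m} {G} {H} f | no none-missed = n , G , stop , record
  { bijection = ⤖⇒↔ (mk⤖ {to = preimage} (preimage-injective ,
      λ x → to f x , λ { refl → injective f (to-preimage (to f x)) }))
  ; adj-≡     = λ x y → trans
      (sym (cong₂ (adj G) (to-preimage x) (to-preimage y)))
      (preserves f (preimage x) (preimage y))
  }
  where
  hit : ∀ v → ∃[ x ] v ≡ to f x
  hit v with any? (λ x → v ≟ to f x)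
  ... | yes h   = h
  ... | no none = contradiction (v , λ x e → none (x , e)) none-missed

  preimage : Fin n → Fin m
  preimage = proj₁ ∘ hit

  to-preimage : ∀ v → to f (preimage v) ≡ v
  to-preimage = sym ∘ proj₂ ∘ hit

  preimage-injective : ∀ {v w} → preimage v ≡ preimage w → v ≡ w
  preimage-injective {v} {w} e =
    trans (sym (to-preimage v)) (trans (cong (to f) e) (to-preimage w))

-- Embeddings under local complementation and pivoting

distinct-≢ : {x y : Fin n} → x ≢ y → distinct x y ≡ true
distinct-≢ {x = x} {y} x≢y = cong not (dec-false (x ≟ y) x≢y)

distinct-to : {H : Graph m} {G : Graph n} (f : H ↪ G) (x y : Fin m) →
  distinct (to f x) (to f y) ≡ distinct x y
distinct-to f x y with x ≟ y
... | yes refl = distinct-irrefl (to f x)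
... | no x≢y   = distinct-≢ (x≢y ∘ injective f)

*-↪ : {H : Graph m} {G : Graph n} (f : H ↪ G) (u : Fin m) → H * u ↪ G * to f u
*-↪ f u = record
  { to        = to f
  ; injective = injective f
  ; preserves = λ x y → cong₂ _xor_ (preserves f x y)
      (cong₂ _∧_ (distinct-to f x y)
        (cong₂ _∧_ (preserves f u x) (preserves f u y)))
  }

edgePivot-↪ : {H : Graph m} {G : Graph n} (f : H ↪ G) (u v : Fin m) →
  edgePivot H u v ↪ edgePivot G (to f u) (to f v)
edgePivot-↪ f u v = *-↪ (*-↪ (*-↪ f u) v) u

minor-of-pivot : {G : Graph n} {H : Graph m} (u v : Fin n) → adj G u v ≡ true →
  ContainsPivotMinor (edgePivot G u v) H → ContainsPivotMinor G H
minor-of-pivot u v uv (k , K , pivoted↝K , K≅H) = k , K , pivot u v uv pivoted↝K , K≅H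

-- For concrete graphs the implicit check evaluates to the unit type and fills itself in.
embedding : {H : Graph m} {G : Graph n} (ys : Vec (Fin n) m) →
  {True (all? λ x → all? λ y → x <? y →-dec
    (¬? (lookup ys x ≟ lookup ys y) ×-dec
     (adj G (lookup ys x) (lookup ys y) ≟ᵇ adj H x y)))} →
  H ↪ G
embedding ys {checked} = ↪-ordered (lookup ys) (λ {x} {y} → toWitness checked x y)

-- The operations on `F` are replayed inside `G`: pivots are carried along `f`, deletions only
-- shrink the embedded graph, and the surplus vertices of `G` are deleted at the end.
minor-of-↪ : {F : Graph k} {G : Graph n} {H : Graph m} →
  F ↪ G → ContainsPivotMinor F H → ContainsPivotMinor G H
minor-of-↪ f (_ , _ , stop , K≅H) = ↪⇒minor (↪-trans (≅⇒↪ K≅H) f)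
minor-of-↪ {F = F} f (_ , K , delete v F-v↝K , K≅H) =
  minor-of-↪ (↪-trans (deletion-↪ F v) f) (_ , K , F-v↝K , K≅H)
minor-of-↪ f (_ , K , pivot u v uv pivoted↝K , K≅H) =
  let l , L , pivoted↝L , L≅H =
        minor-of-↪ (edgePivot-↪ f u v) (_ , K , pivoted↝K , K≅H)
  in l , L , pivot (to f u) (to f v) (trans (preserves f u v) uv) pivoted↝L , L≅H

-- Adjacencies after an edge pivot

*-centre : (G : Graph n) (u x : Fin n) → adj (G * u) u x ≡ adj G u x
*-centre G u x rewrite no-loop G u | ∧-zeroʳ (distinct u x) =
  xor-identityʳ (adj G u x)

*-distinct : (G : Graph n) (u : Fin n) {x y : Fin n} → x ≢ y →
  adj (G * u) x y ≡ adj G x y xor (adj G u x ∧ adj G u y)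
*-distinct G u x≢y rewrite distinct-≢ x≢y = refl

xor-cancelˡ : ∀ a b → a xor (b xor a) ≡ b
xor-cancelˡ = solve 2 (λ a b → a :+ (b :+ a) := b) refl

xor-cancelʳ : ∀ a b → (b xor a) xor b ≡ a
xor-cancelʳ = solve 2 (λ a b → (b :+ a) :+ b := a) refl

module _ (G : Graph n) {u v : Fin n} (uv : adj G u v ≡ true) where

  private
    G₁ G₂ : Graph n
    G₁ = G * u
    G₂ = G₁ * v

  edge-distinct : u ≢ v
  edge-distinct refl with trans (sym uv) (no-loop G u)
  ... | ()

  private
    adj₁-v : ∀ {x} → x ≢ v → adj G₁ v x ≡ adj G v x xor adj G u x
    adj₁-v x≢v = trans (*-distinct G u (x≢v ∘ sym))
      (cong (λ b → adj G v _ xor (b ∧ adj G u _)) uv)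

    adj₂-v : ∀ {x} → x ≢ v → adj G₂ v x ≡ adj G v x xor adj G u x
    adj₂-v {x} x≢v = trans (*-centre G₁ v x) (adj₁-v x≢v)

    adj₁-vu : adj G₁ v u ≡ true
    adj₁-vu = trans (adj-sym G₁ v u) (trans (*-centre G u v) uv)

    adj₂-uv : adj G₂ u v ≡ true
    adj₂-uv = trans (adj-sym G₂ u v) (trans (*-centre G₁ v u) adj₁-vu)

    adj₂-u : ∀ {x} → x ≢ u → x ≢ v → adj G₂ u x ≡ adj G v x
    adj₂-u {x} x≢u x≢v = begin
      adj G₂ u x
        ≡⟨ *-distinct G₁ v (x≢u ∘ sym) ⟩
      adj G₁ u x xor (adj G₁ v u ∧ adj G₁ v x)
        ≡⟨ cong₂ (λ a b → a xor (b ∧ adj G₁ v x)) (*-centre G u x) adj₁-vu ⟩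
      adj G u x xor adj G₁ v x
        ≡⟨ cong (adj G u x xor_) (adj₁-v x≢v) ⟩
      adj G u x xor (adj G v x xor adj G u x)
        ≡⟨ xor-cancelˡ (adj G u x) (adj G v x) ⟩
      adj G v x ∎
      where open ≡-Reasoning

  pivot-edge : adj (edgePivot G u v) u v ≡ true
  pivot-edge = trans (*-centre G₂ u v) adj₂-uv

  -- A pivot exchanges the neighbourhoods of `u` and `v` outside the edge: complementing at `u`
  -- turns that of `v` into the symmetric difference of both, and complementing at `v` then turns
  -- that of `u` into the old one of `v`.
  pivot-first : ∀ {x} → x ≢ u → x ≢ v → adj (edgePivot G u v) u x ≡ adj G v x
  pivot-first {x} x≢u x≢v = trans (*-centre G₂ u x) (adj₂-u x≢u x≢v)

  pivot-second : ∀ {x} → x ≢ u → x ≢ v → adj (edgePivot G u v) v x ≡ adj G u x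
  pivot-second {x} x≢u x≢v = begin
    adj (edgePivot G u v) v x
      ≡⟨ *-distinct G₂ u (x≢v ∘ sym) ⟩
    adj G₂ v x xor (adj G₂ u v ∧ adj G₂ u x)
      ≡⟨ cong₂ (λ a b → a xor (b ∧ adj G₂ u x)) (adj₂-v x≢v) adj₂-uv ⟩
    (adj G v x xor adj G u x) xor adj G₂ u x
      ≡⟨ cong ((adj G v x xor adj G u x) xor_) (adj₂-u x≢u x≢v) ⟩
    (adj G v x xor adj G u x) xor adj G v x
      ≡⟨ xor-cancelʳ (adj G u x) (adj G v x) ⟩
    adj G u x ∎
    where open ≡-Reasoning

  -- Solved for the adjacency before pivoting.
  pivot-others : ∀ {x y} → x ≢ u → x ≢ v → y ≢ u → y ≢ v → x ≢ y →
    adj (edgePivot G u v) x y xor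
      ((adj G u x ∧ adj G v y) xor (adj G u y ∧ adj G v x)) ≡ adj G x y
  pivot-others {x} {y} x≢u x≢v y≢u y≢v x≢y = trans
    (cong (_xor ((adj G u x ∧ adj G v y) xor (adj G u y ∧ adj G v x))) expand)
    (cancel (adj G x y) (adj G u x) (adj G u y) (adj G v x) (adj G v y))
    where
    -- The three added products come from complementing at `u`, at `v` and again at `u`; modulo 2
    -- they sum to the correction term.
    expand : adj (edgePivot G u v) x y ≡
      ((adj G x y xor (adj G u x ∧ adj G u y))
        xor ((adj G v x xor adj G u x) ∧ (adj G v y xor adj G u y)))
      xor (adj G v x ∧ adj G v y)
    expand = trans (*-distinct G₂ u x≢y) (cong₂ _xor_
      (trans (*-distinct G₁ v x≢y) (cong₂ _xor_
        (*-distinct G u x≢y)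
        (cong₂ _∧_ (adj₁-v x≢v) (adj₁-v y≢v))))
      (cong₂ _∧_ (adj₂-u x≢u x≢v) (adj₂-u y≢u y≢v)))

    cancel : ∀ xy ux uy vx vy →
      (((xy xor (ux ∧ uy)) xor ((vx xor ux) ∧ (vy xor uy))) xor (vx ∧ vy))
        xor ((ux ∧ vy) xor (uy ∧ vx)) ≡ xy
    cancel = solve 5 (λ xy ux uy vx vy →
      (((xy :+ (ux :* uy)) :+ ((vx :+ ux) :* (vy :+ uy))) :+ (vx :* vy))
        :+ ((ux :* vy) :+ (uy :* vx)) := xy) refl

-- Backtracking search in partially known graphs

infixr 5 _▷_

data Triangle (A : Set) : ℕ → Set where
  []  : Triangle A 0
  _▷_ : Vec A n → Triangle A n → Triangle A (suc n)

triangle : (Fin n → Fin n → A) → Triangle A n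
triangle {n = zero}  h = []
triangle {n = suc n} h =
  tabulate (λ j → h zero (suc j)) ▷ triangle (λ i j → h (suc i) (suc j))

-- What is known of the adjacencies between listed vertices, which may repeat;
-- "just" also asserts that the two vertices are different.
Table : ℕ → Set
Table = Triangle (Maybe Bool)

entry : Table k → Fin k → Fin k → Maybe Bool
-- Unknown, because a `just` entry would declare a vertex different from itself.
entry (r ▷ t) zero    zero    = nothing
entry (r ▷ t) zero    (suc j) = lookup r j
entry (r ▷ t) (suc i) zero    = lookup r i
entry (r ▷ t) (suc i) (suc j) = entry t i j

_is_ : Maybe Bool → Bool → Bool
just true  is b = b
just false is b = not b
nothing    is b = false

is⇒≡ : ∀ a {b} → T (just a is b) → a ≡ b
is⇒≡ true  {true}  _ = refl
is⇒≡ false {false} _ = refl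

filters : (Bool → Fin k → Bool) →
  Vec Bool m → Vec (List (Fin k)) m → Vec (List (Fin k)) m
filters p = zipWith (λ b → filterᵇ (p b))

-- Each vertex of the pattern has a list of candidate places.
search : Table k → Triangle Bool m → Vec (List (Fin k)) m → Bool
search t []      []       = true
search t (r ▷ h) (c ∷ cs) =
  any (λ x → search t h (filters (λ b y → entry t x y is b) r cs)) c

-- Every table extends, by its vertex zero, one without patterns, so only the
-- copies using that vertex matter.
rooted : ∀ m → Vec (List (Fin (suc k))) m
rooted zero    = []
rooted (suc m) = (zero ∷ []) ∷ replicate m (map suc (allFin _))

-- Every choice filters the candidates of the later vertices, so membership in a filtered list
-- carries the match with the vertex just placed.
search-sound : (t : Table k) (h : Fin m → Fin m → Bool)
  (cs : Vec (List (Fin k)) m) → T (search t (triangle h) cs) →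
  Σ[ ys ∈ Vec (Fin k) m ]
    (∀ i → lookup ys i List.∈ lookup cs i) ×
    (∀ {i j} → i < j → T (entry t (lookup ys i) (lookup ys j) is h i j))
search-sound {m = zero}  t h []       found = [] , (λ ()) , λ {}
search-sound {m = suc m} t h (c ∷ cs) found
  with x , x∈c , found′ ← List.find (Any.any⁻ _ c found)
  with ys , ys∈ , ordered ← search-sound t (λ i j → h (suc i) (suc j)) _ found′
  = x ∷ ys , candidates , matches
  where
  filtered : ∀ j →
    lookup ys j List.∈ lookup cs j × T (entry t x (lookup ys j) is h zero (suc j))
  filtered j = ∈-filter⁻ _ (subst (lookup ys j List.∈_)
    (trans (lookup-zipWith _ j (tabulate (h zero ∘ suc)) cs)
      (cong (λ b → filterᵇ (λ y → entry t x y is b) (lookup cs j))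
        (lookup∘tabulate _ j)))
    (ys∈ j))

  candidates : ∀ i → lookup (x ∷ ys) i List.∈ lookup (c ∷ cs) i
  candidates zero    = x∈c
  candidates (suc j) = proj₁ (filtered j)

  matches : ∀ {i j} → i < j →
    T (entry t (lookup (x ∷ ys) i) (lookup (x ∷ ys) j) is h i j)
  matches {zero}  {suc j} _         = proj₂ (filtered j)
  matches {suc i} {suc j} (s<s i<j) = ordered i<j

-- Enumeration of the possible graphs before a pivot

-- The place of a vertex relative to a pivoted edge uv: equal to u, equal to v,
-- or neither, with the given adjacencies to u and to v before pivoting.
data Kind : Set where
  first second : Kind
  other        : Bool → Bool → Kind

kinds : List Kind
kinds =
  first ∷ second ∷
  other false false ∷ other false true ∷ other true false ∷ other true true ∷ []

-- Whether different vertices of the given kinds can have adjacency h after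
-- pivoting.
consistent : Bool → Kind → Kind → Bool
consistent h first       first       = false
consistent h first       second      = h
consistent h first       (other _ b) = ⌊ h ≟ᵇ b ⌋
consistent h second      first       = h
consistent h second      second      = false
consistent h second      (other a _) = ⌊ h ≟ᵇ a ⌋
consistent h (other _ b) first       = ⌊ h ≟ᵇ b ⌋
consistent h (other a _) second      = ⌊ h ≟ᵇ a ⌋
consistent h (other _ _) (other _ _) = true

consistentRow : Kind → Vec Bool m → Vec Kind m → Bool
consistentRow c []      []       = true
consistentRow c (h ∷ r) (d ∷ ds) = consistent h c d ∧ consistentRow c r ds

-- The adjacency before pivoting; nothing need be recorded for copies of u and
-- v, which are in every table already.
before : Bool → Kind → Kind → Maybe Bool
before h (other a b) (other a′ b′) = just (h xor ((a ∧ b′) xor (a′ ∧ b)))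
before h _           _             = nothing

-- The last two entries of a row, since every table ends with `u` and `v` in this order.
beforeEdge : Kind → Vec (Maybe Bool) 2
beforeEdge (other a b) = just a ∷ just b ∷ []
beforeEdge _           = nothing ∷ nothing ∷ []

beforeRow : Kind → Vec Bool m → Vec Kind m → Vec (Maybe Bool) (m + 2)
beforeRow c []      []       = beforeEdge c
beforeRow c (h ∷ r) (d ∷ ds) = before h c d ∷ beforeRow c r ds

edgeTable : Table 2
edgeTable = (just true ∷ []) ▷ [] ▷ []

-- A vertex equal to `u` or `v` brings a row without known entries, so no new search is made after
-- it.
informative : Kind → Bool
informative (other _ _) = true
informative _           = false

contains : List (∃ (Triangle Bool)) → Table (suc k) → Bool
contains Ps t = any (λ (m , P) → search t P (rooted m)) Ps

settled : List (∃ (Triangle Bool)) →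
  Vec Bool m → Table (m + 2) → Vec Kind m →
  (Table (suc m + 2) → Vec Kind (suc m) → Bool) → Kind → Bool
settled Ps r t ds κ c =
  not (consistentRow c r ds) ∨ ((informative c ∧ contains Ps t′) ∨ κ t′ (c ∷ ds))
  where
  t′ : Table _
  t′ = beforeRow c r ds ▷ t

-- Builds a copy of a graph in the pivoted graph vertex by vertex, discarding
-- the branches where a pattern appears before pivoting, and asks all remaining
-- outcomes to satisfy κ.
explore : List (∃ (Triangle Bool)) → Triangle Bool m →
  (Table (m + 2) → Vec Kind m → Bool) → Bool
explore Ps []      κ = κ edgeTable []
explore Ps (r ▷ h) κ = explore Ps h λ t ds → all (settled Ps r t ds κ) kinds

-- Soundness of tables and of the search

module _ (G : Graph n) where

  record Knows (e : Maybe Bool) (x y : Fin n) : Set where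
    constructor mkKnows
    field known : ∀ {b} → T (e is b) → x ≢ y × adj G x y ≡ b

  record Sound (t : Table k) (vs : Vec (Fin n) k) : Set where
    constructor mkSound
    field knowledge : ∀ i j → Knows (entry t i j) (lookup vs i) (lookup vs j)

  open Knows
  open Sound

  knows-nothing : ∀ {x y} → Knows nothing x y
  knows-nothing = mkKnows λ ()

  knows-just : ∀ {a x y} → x ≢ y → adj G x y ≡ a → Knows (just a) x y
  knows-just {a} x≢y xy = mkKnows λ a-is-b → x≢y , trans xy (is⇒≡ a a-is-b)

  knows-sym : ∀ {e x y} → Knows e x y → Knows e y x
  knows-sym e-known = mkKnows λ eb →
    let x≢y , xy = known e-known eb in x≢y ∘ sym , trans (adj-sym G _ _) xy

  sound-▷ : ∀ {r : Vec (Maybe Bool) k} {t x vs} →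
    Pointwise (λ e y → Knows e x y) r vs → Sound t vs → Sound (r ▷ t) (x ∷ vs)
  sound-▷ row sound = mkSound λ where
    zero    zero    → knows-nothing
    zero    (suc j) → Pointwise.lookup row j
    (suc i) zero    → knows-sym (Pointwise.lookup row i)
    (suc i) (suc j) → knowledge sound i j

  -- The vertices in `vs` may repeat; injectivity comes from the distinctness that every known entry
  -- asserts.
  search-↪ : {t : Table k} {vs : Vec (Fin n) k}
    (H : Graph m) (cs : Vec (List (Fin k)) m) →
    Sound t vs → T (search t (triangle (adj H)) cs) → H ↪ G
  search-↪ {t = t} {vs} H cs sound found =
    let ys , _ , matches = search-sound t (adj H) cs found in
    ↪-ordered (λ i → lookup vs (lookup ys i)) λ i<j →
      known (knowledge sound _ _) (matches i<j)

patterns : List (∃ Graph) → List (∃ (Triangle Bool))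
patterns = map λ (m , P) → m , triangle (adj P)

-- Soundness of the enumeration for a given pivot

module _ (G : Graph n) {u v : Fin n} (uv : adj G u v ≡ true)
         {Ps : List (∃ Graph)} (avoids : G Avoids Ps) where

  private
    G∧uv : Graph n
    G∧uv = edgePivot G u v

  data HasKind (x : Fin n) : Kind → Set where
    first  : x ≡ u → HasKind x first
    second : x ≡ v → HasKind x second
    other  : x ≢ u → x ≢ v → HasKind x (other (adj G u x) (adj G v x))

  classify : ∀ x → ∃[ c ] c List.∈ kinds × HasKind x c
  classify x with x ≟ u | x ≟ v
  ... | yes x≡u | _       = first , here refl , first x≡u
  ... | no _    | yes x≡v = second , there (here refl) , second x≡v
  ... | no x≢u  | no x≢v  =
    _ , there (there (listed (adj G u x) (adj G v x))) , other x≢u x≢v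
    where
    listed : ∀ a b → other a b List.∈
      (other false false ∷ other false true ∷ other true false ∷ other true true ∷ [])
    listed false false = here refl
    listed false true  = there (here refl)
    listed true  false = there (there (here refl))
    listed true  true  = there (there (there (here refl)))

  -- Since the pivot exchanges the outer neighbourhoods of `u` and `v`, comparing with the old
  -- adjacency to the opposite end never rejects a pair that occurs.
  consistent-complete : ∀ {x y c d} → HasKind x c → HasKind y d → x ≢ y →
    T (consistent (adj G∧uv x y) c d)
  consistent-complete (first refl) (first refl) x≢y = contradiction refl x≢y
  consistent-complete (first refl) (second refl) _ =
    Equivalence.from T-≡ (pivot-edge G uv)
  consistent-complete (first refl) (other y≢u y≢v) _ =
    fromWitness (pivot-first G uv y≢u y≢v)
  consistent-complete (second refl) (first refl) _ =
    Equivalence.from T-≡ (trans (adj-sym G∧uv v u) (pivot-edge G uv))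
  consistent-complete (second refl) (second refl) x≢y = contradiction refl x≢y
  consistent-complete (second refl) (other y≢u y≢v) _ =
    fromWitness (pivot-second G uv y≢u y≢v)
  consistent-complete (other x≢u x≢v) (first refl) _ =
    fromWitness (trans (adj-sym G∧uv _ u) (pivot-first G uv x≢u x≢v))
  consistent-complete (other x≢u x≢v) (second refl) _ =
    fromWitness (trans (adj-sym G∧uv _ v) (pivot-second G uv x≢u x≢v))
  consistent-complete (other _ _) (other _ _) _ = _

  before-sound : ∀ {x y c d} → HasKind x c → HasKind y d → x ≢ y →
    Knows G (before (adj G∧uv x y) c d) x y
  before-sound (other x≢u x≢v) (other y≢u y≢v) x≢y =
    knows-just G x≢y (sym (pivot-others G uv x≢u x≢v y≢u y≢v x≢y))
  before-sound (other _ _) (first _)   _ = knows-nothing G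
  before-sound (other _ _) (second _)  _ = knows-nothing G
  before-sound (first _)   _           _ = knows-nothing G
  before-sound (second _)  _           _ = knows-nothing G

  beforeEdge-sound : ∀ {x c} → HasKind x c →
    Pointwise (λ e y → Knows G e x y) (beforeEdge c) (u ∷ v ∷ [])
  beforeEdge-sound (first _)         = knows-nothing G ∷ knows-nothing G ∷ []
  beforeEdge-sound (second _)        = knows-nothing G ∷ knows-nothing G ∷ []
  beforeEdge-sound (other x≢u x≢v) =
    knows-just G x≢u (adj-sym G _ u) ∷ knows-just G x≢v (adj-sym G _ v) ∷ []

  edgeTable-sound : Sound G edgeTable (u ∷ v ∷ [])
  edgeTable-sound = sound-▷ G (knows-just G (edge-distinct G uv) uv ∷ [])
    (sound-▷ G [] (mkSound λ ()))

  module _ {x : Fin n} {c : Kind} (x-kind : HasKind x c) where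

    consistentRow-complete : {h : Fin m → Bool} {xs : Vec (Fin n) m} {ds : Vec Kind m} →
      Pointwise HasKind xs ds →
      (∀ j → x ≢ lookup xs j) → (∀ j → adj G∧uv x (lookup xs j) ≡ h j) →
      T (consistentRow c (tabulate h) ds)
    consistentRow-complete []                  x≢xs x-xs = _
    consistentRow-complete (y-kind ∷ xs-kinds) x≢xs x-xs = Equivalence.from T-∧
      ( subst (λ b → T (consistent b c _)) (x-xs zero)
          (consistent-complete x-kind y-kind (x≢xs zero))
      , consistentRow-complete xs-kinds (x≢xs ∘ suc) (x-xs ∘ suc))

    beforeRow-sound : {h : Fin m → Bool} {xs : Vec (Fin n) m} {ds : Vec Kind m} →
      Pointwise HasKind xs ds →
      (∀ j → x ≢ lookup xs j) → (∀ j → adj G∧uv x (lookup xs j) ≡ h j) →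
      Pointwise (λ e y → Knows G e x y)
        (beforeRow c (tabulate h) ds) (xs ++ u ∷ v ∷ [])
    beforeRow-sound []                  x≢xs x-xs = beforeEdge-sound x-kind
    beforeRow-sound (y-kind ∷ xs-kinds) x≢xs x-xs =
      subst (λ b → Knows G (before b c _) x _) (x-xs zero)
        (before-sound x-kind y-kind (x≢xs zero))
      ∷ beforeRow-sound xs-kinds (x≢xs ∘ suc) (x-xs ∘ suc)

  contains-none : ∀ {t : Table (suc k)} {vs} → Sound G t vs →
    ¬ T (contains (patterns Ps) t)
  contains-none sound found = All.All¬⇒¬Any avoids
    (Any.map (search-↪ G _ (rooted _) sound)
      (Any.map⁻ {xs = Ps} (Any.any⁻ _ (patterns Ps) found)))

  -- Only the branch given by the actual kinds of `xs` is followed. It is never inconsistent, and no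
  -- pattern appears on it because `G` avoids them all, so it must satisfy `κ`.
  explore-sound : (h : Fin m → Fin m → Bool) (κ : Table (m + 2) → Vec Kind m → Bool)
    (xs : Vec (Fin n) m) → (∀ {i j} → lookup xs i ≡ lookup xs j → i ≡ j) →
    (∀ i j → adj G∧uv (lookup xs i) (lookup xs j) ≡ h i j) →
    T (explore (patterns Ps) (triangle h) κ) →
    ∃₂ λ t ds → Sound G t (xs ++ u ∷ v ∷ []) × Pointwise HasKind xs ds × T (κ t ds)
  explore-sound {m = zero}  h κ []       inj copy ok = _ , _ , edgeTable-sound , [] , ok
  explore-sound {m = suc m} h κ (x ∷ xs) inj copy ok
    with t , ds , sound , xs-kinds , all-ok ← explore-sound _ _ xs
           (λ e → suc-injective (inj e)) (λ i j → copy (suc i) (suc j)) ok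
    with c , c∈kinds , x-kind ← classify x
    = _ , _ , sound′ , x-kind ∷ xs-kinds ,
      conclude (All.lookup (All.all⁺ (settled (patterns Ps) r t ds κ) kinds all-ok)
        c∈kinds)
    where
    r : Vec Bool m
    r = tabulate (h zero ∘ suc)

    x≢xs : ∀ j → x ≢ lookup xs j
    x≢xs j e with inj {zero} {suc j} e
    ... | ()

    sound′ : Sound G (beforeRow c r ds ▷ t) (x ∷ xs ++ u ∷ v ∷ [])
    sound′ = sound-▷ G
      (beforeRow-sound x-kind {h = h zero ∘ suc} xs-kinds x≢xs (copy zero ∘ suc)) sound

    conclude : T (settled (patterns Ps) r t ds κ c) →
      T (κ (beforeRow c r ds ▷ t) (c ∷ ds))
    conclude some with Equivalence.to T-∨ some
    ... | inj₁ inconsistent = contradiction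
      (consistentRow-complete x-kind xs-kinds x≢xs (copy zero ∘ suc))
      (T-not inconsistent)
      where
      T-not : ∀ {b} → T (not b) → ¬ T b
      T-not {false} _ ()
    ... | inj₂ rest with Equivalence.to T-∨ rest
    ...   | inj₁ found = contradiction
      (proj₂ (Equivalence.to (T-∧ {informative c}) found)) (contains-none sound′)
    ...   | inj₂ good  = good

  -- With a constantly false continuation the exploration succeeds only if every branch is cut off,
  -- whereas a real copy would leave one surviving.
  refuted-↪ : (H : Graph m) →
    T (explore (patterns Ps) (triangle (adj H)) λ _ _ → false) → ¬ H ↪ G∧uv
  refuted-↪ H refuted f =
    let _ , _ , _ , _ , absurd = explore-sound (adj H) _ (tabulate (to f))
          (λ e → injective f (trans (sym (image _)) (trans e (image _))))
          (λ i j → trans (cong₂ (adj G∧uv) (image i) (image j)) (preserves f i j))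
          refuted
    in absurd
    where
    image : ∀ i → lookup (tabulate (to f)) i ≡ to f i
    image = lookup∘tabulate (to f)

-- Rerooted patterns and invariance under pivot-minors

reroot : Graph n → Fin n → Graph n
-- Exchanging `v` with vertex zero makes `v` the vertex that a rooted search pins to the newest
-- vertex of the table.
reroot {suc n} H v = induced H (mk↣ {to = transpose zero v} injective′)
  where
  injective′ : ∀ {i j} → transpose zero v i ≡ transpose zero v j → i ≡ j
  injective′ e = trans (sym (transpose-inverse v zero))
    (trans (cong (transpose v zero) e) (transpose-inverse v zero))

↪-reroot : (H : Graph n) (v : Fin n) → H ↪ reroot H v
↪-reroot {suc n} H v = record
  { to        = transpose v zero
  ; injective = λ e → trans (sym (transpose-inverse zero v))
      (trans (cong (transpose zero v) e) (transpose-inverse zero v))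
  ; preserves = λ x y →
      cong₂ (adj H) (transpose-inverse zero v) (transpose-inverse zero v)
  }

-- When the roots meet every orbit of the automorphism group, a rooted search
-- for the rerootings misses no copy; soundness holds for any roots.
RootedGraph : Set
RootedGraph = Σ[ (n , _) ∈ ∃ Graph ] List (Fin n)

graphs : List RootedGraph → List (∃ Graph)
graphs = map proj₁

rerootings : List RootedGraph → List (∃ Graph)
rerootings = concatMap λ ((n , H) , roots) → map (λ v → n , reroot H v) roots

avoids-rerootings : {G : Graph n} (Rs : List RootedGraph) →
  G Avoids graphs Rs → G Avoids rerootings Rs
avoids-rerootings Rs free = All.concat⁺ (All.map⁺ (All.map
  (λ {((_ , H) , roots)} avoided → All.map⁺
    (All.universal (λ v f → avoided (↪-trans (↪-reroot H v) f)) roots))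
  (All.map⁻ free)))

-- Rerooting concerns the graphs sought before the pivot; the copies after it are explored in their
-- given order.
pivotClosed : List RootedGraph → Bool
pivotClosed Rs =
  all (λ (_ , H) → explore Ps (triangle (adj H)) λ _ _ → false) (graphs Rs)
  where
  Ps : List (∃ (Triangle Bool))
  Ps = patterns (rerootings Rs)

avoids-↝ : (Rs : List RootedGraph) → T (pivotClosed Rs) →
  {G : Graph m} {K : Graph n} → G ↝ K → G Avoids graphs Rs → K Avoids graphs Rs
avoids-↝ Rs closed stop avoids = avoids
avoids-↝ Rs closed (delete {G = G} v G-v↝K) avoids = avoids-↝ Rs closed G-v↝K
  (All.map (λ avoided f → avoided (↪-trans f (deletion-↪ G v))) avoids)
avoids-↝ Rs closed (pivot {G = G} u v uv G∧uv↝K) avoids = avoids-↝ Rs closed G∧uv↝K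
  (All.map (λ {(_ , H)} → refuted-↪ G uv (avoids-rerootings Rs avoids) H)
    (All.all⁺ _ (graphs Rs) closed))

-- The two characterisations

pivotMinorFree⇔ : (H : Graph m) (roots : List (Fin m)) (Rs : List RootedGraph) →
  (let Rs⁺ = ((m , H) , roots) ∷ Rs) →
  All (λ (_ , F) → ContainsPivotMinor F H) (graphs Rs⁺) → T (pivotClosed Rs⁺) →
  (n : ℕ) (G : Graph n) → PivotMinorFree H G ⇔ (G IsFreeOf graphs Rs⁺)
pivotMinorFree⇔ H roots Rs minors closed n G = mk⇔
  (λ H-free → All.map (λ H≤F F⊆G → H-free (minor-of-↪ (induced⇒↪ F⊆G) H≤F)) minors)
  (λ free (_ , K , G↝K , K≅H) → All.head (avoids-↝ _ closed G↝K
    (All.map (λ F⊈G f → F⊈G (↪⇒induced f)) free)) (≅⇒↪ K≅H))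

theorem7p1 : ((n : ℕ) (G : Graph n) →
    PivotMinorFree 3P₁ G ⇔
    (G IsFreeOf ((3 , 3P₁) ∷ (5 , W₄) ∷ (7 , complement BW₃) ∷ [])))
    ×
    ((n : ℕ) (G : Graph n) →
    PivotMinorFree K₁,₃ G ⇔
    (G IsFreeOf ((4 , K₁,₃) ∷ (5 , P₅) ∷ (5 , bull) ∷ (5 , W₄) ∷ (7 , complement BW₃) ∷ [])))
theorem7p1 =
  pivotMinorFree⇔ 3P₁ (0F ∷ []) (W₄-rooted ∷ BW₃ᶜ-rooted ∷ [])
    ( ↪⇒minor ↪-refl
    -- In the triangle `2F`, `3F`, `4F` the vertices see only `1F`, only `0F`, and both; the pivot
    -- complements all three pairs.
    ∷ minor-of-pivot 1F 0F refl (↪⇒minor (embedding (2F ∷ 3F ∷ 4F ∷ [])))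
    -- The first pivot turns the vertices other than `0F` and `2F` into a `W₄` with hub `1F` and rim
    -- 3-6-5-4; the second pivots one of its spokes.
    ∷ minor-of-pivot 2F 0F refl (minor-of-pivot 3F 1F refl
      (↪⇒minor (embedding (4F ∷ 5F ∷ 6F ∷ []))))
    ∷ [])
    -- Evaluation of the finite search reduces this argument to the unit type.
    _ ,
  pivotMinorFree⇔ K₁,₃ (0F ∷ 1F ∷ [])
    (((5 , P₅) , 0F ∷ 1F ∷ 2F ∷ []) ∷ ((5 , bull) , 0F ∷ 1F ∷ 2F ∷ [])
      ∷ W₄-rooted ∷ BW₃ᶜ-rooted ∷ [])
    ( ↪⇒minor ↪-refl
    -- In `P₅` and in `bull` alike, this pivot leaves `3F` as the centre of a claw with leaves `0F`,
    -- `1F` and `4F`.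
    ∷ minor-of-pivot 2F 1F refl (↪⇒minor (embedding (3F ∷ 0F ∷ 1F ∷ 4F ∷ [])))
    ∷ minor-of-pivot 2F 1F refl (↪⇒minor (embedding (3F ∷ 0F ∷ 1F ∷ 4F ∷ [])))
    -- Pivoting a spoke gives the rim vertex the neighbours of the hub and makes the rest of the rim
    -- independent.
    ∷ minor-of-pivot 4F 0F refl (↪⇒minor (embedding (0F ∷ 1F ∷ 2F ∷ 3F ∷ [])))
    ∷ minor-of-pivot 2F 0F refl (minor-of-pivot 3F 1F refl
      (↪⇒minor (embedding (3F ∷ 4F ∷ 5F ∷ 6F ∷ []))))
    ∷ [])
    _
  where
  W₄-rooted BW₃ᶜ-rooted : RootedGraph
  -- One rim vertex and the hub represent the two orbits.
  W₄-rooted = (5 , W₄) , 0F ∷ 4F ∷ []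
  -- The orbits consist of 0, 2, 4, of 1, 3, 5, and of 6 alone.
  BW₃ᶜ-rooted = (7 , complement BW₃) , 0F ∷ 1F ∷ 6F ∷ []
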